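{- Let $A,B$ and $S$ be non-empty subsets of a finite Abelian group $G$. Assume that $|A|+|B|=|G|+L_S$, where $L_S=|S|\,L(G)$, and that $|A\wedge^S B|=|G|-2|S|$. Then (i) there exists a subgroup $H$ of $2\cdot G$ such that $S$ is a coset modulo $H$, and (ii) $G\setminus(A\wedge^S B)$ is a union of two cosets modulo $H$.
   Context: Groups are written additively. For subsets $A,B,S$ of a finite Abelian group $G$: $A\wedge^S B=\{a+b:\ a\in A,\ b\in B,\ a-b\notin S\}$. For $z\in G$, $L_S(z)=|\{(x,y)\in G\times G:\ x+y=z,\ x-y\in S\}|$, and $L_S=\max_{z\in G}L_S(z)$. $L(G)=|\{x\in G:2x=0\}|$ and $2\cdot G=\{2x:x\in G\}$. -}

module Defs where

open import Algebra.Bundles using (AbelianGroup)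
open import Data.Fin.Base using (Fin)
open import Data.Fin.Properties using (any?; inj⇒≟)
open import Data.Fin.Subset using (Subset; ∣_∣)
open import Data.Fin.Subset.Properties using (_∈?_)
open import Data.List.Base using (List; allFin; cartesianProduct; filter; length; map)
open import Data.List.Extrema.Nat using (max)
open import Data.Nat.Base using (ℕ)
open import Data.Product.Base using (_×_; _,_; ∃; ∃₂)
open import Data.Vec.Base using (tabulate)
open import Function.Base using (_∘_)
open import Function.Bundles using (Inverse)
open import Function.Properties.Inverse using (Inverse⇒Injection)
open import Level using (Level; suc; _⊔_)
open import Relation.Binary.Definitions using (_Respects_) renaming (Decidable to Decidable₂)
open import Relation.Binary.PropositionalEquality using (setoid; subst)
open import Relation.Nullary.Decidable using (Dec; does; map′; _×-dec_; ¬?)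
open import Relation.Nullary.Negation using (¬_)
open import Relation.Unary using (Pred; Decidable; _≐_; _∪_; _∈_)
import Data.Fin.Subset as Fin

record FiniteAbelianGroup (c ℓ : Level) : Set (suc (c ⊔ ℓ)) where
  field
    abelianGroup : AbelianGroup c ℓ
    order        : ℕ
    enumeration  : Inverse (AbelianGroup.setoid abelianGroup) (setoid (Fin order))

  open AbelianGroup abelianGroup public
    renaming (_∙_ to _+_; ε to 0#; _⁻¹ to -_; setoid to ≈-setoid)

-- Subsets of the group are the `Subset order` of the library, read through the
-- enumeration; `⟪ A ⟫` is the corresponding predicate on group elements.
module Subsets {c ℓ : Level} (G : FiniteAbelianGroup c ℓ) where

  open FiniteAbelianGroup G
  open Inverse enumeration using (to; from; to-cong; strictlyInverseʳ)

  _≟_ : Decidable₂ _≈_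
  _≟_ = inj⇒≟ (Inverse⇒Injection enumeration)

  ⟪_⟫ : Subset order → Pred Carrier _
  ⟪ A ⟫ x = to x Fin.∈ A

  _∈ᴳ?_ : ∀ x A → Dec (x ∈ ⟪ A ⟫)
  x ∈ᴳ? A = to x ∈? A

  ⟪⟫-resp-≈ : ∀ A → ⟪ A ⟫ Respects _≈_
  ⟪⟫-resp-≈ A x≈y = subst (Fin._∈ A) (to-cong x≈y)

  ∃? : ∀ {p} {P : Pred Carrier p} → P Respects _≈_ → Decidable P → Dec (∃ P)
  ∃? resp P? = map′
    (λ (i , p) → from i , p)
    (λ (x , p) → to x , resp (sym (strictlyInverseʳ x)) p)
    (any? (P? ∘ from))

  comprehension : ∀ {p} {P : Pred Carrier p} → Decidable P → Subset order
  comprehension P? = tabulate (does ∘ P? ∘ from)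

  elements : List Carrier
  elements = map from (allFin order)

  RestrictedSum : (A S B : Subset order) → Pred Carrier _
  RestrictedSum A S B z =
    ∃₂ λ a b → (a ∈ ⟪ A ⟫ × b ∈ ⟪ B ⟫ × ¬ (a - b ∈ ⟪ S ⟫)) × z ≈ a + b

  restrictedSum? : ∀ A S B → Decidable (RestrictedSum A S B)
  restrictedSum? A S B z =
    ∃? (λ a≈a′ (b , (a∈A , b∈B , a-b∉S) , z≈a+b) →
          b , (⟪⟫-resp-≈ A a≈a′ a∈A , b∈B
              , a-b∉S ∘ ⟪⟫-resp-≈ S (∙-congʳ (sym a≈a′)))
            , trans z≈a+b (∙-congʳ a≈a′))
       λ a →
    ∃? (λ b≈b′ ((a∈A , b∈B , a-b∉S) , z≈a+b) →
          (a∈A , ⟪⟫-resp-≈ B b≈b′ b∈B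
              , a-b∉S ∘ ⟪⟫-resp-≈ S (∙-congˡ (⁻¹-cong (sym b≈b′))))
            , trans z≈a+b (∙-congˡ b≈b′))
       λ b →
    (a ∈ᴳ? A ×-dec b ∈ᴳ? B ×-dec ¬? ((a - b) ∈ᴳ? S)) ×-dec (z ≟ (a + b))

  -- A ∧[ S ] B = { a + b : a ∈ A, b ∈ B, a - b ∉ S }
  _∧[_]_ : (A S B : Subset order) → Subset order
  A ∧[ S ] B = comprehension (restrictedSum? A S B)

  -- Lᶻ S z is L_S(z), Lˢ S is L_S = max_z L_S(z), and Lᴳ is L(G).
  Lᶻ : Subset order → Carrier → ℕ
  Lᶻ S z = length (filter
    (λ (x , y) → ((x + y) ≟ z) ×-dec ((x - y) ∈ᴳ? S))
    (cartesianProduct elements elements))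

  -- The default value 0 is harmless: `elements` is never empty.
  Lˢ : Subset order → ℕ
  Lˢ S = max 0 (map (Lᶻ S) elements)

  Lᴳ : ℕ
  Lᴳ = ∣ comprehension (λ x → (x + x) ≟ 0#) ∣

  2·G : Pred Carrier _
  2·G x = ∃ λ y → x ≈ y + y

  record IsSubgroup (H : Subset order) : Set (c ⊔ ℓ) where
    field
      0∈       : 0# ∈ ⟪ H ⟫
      +-closed : ∀ {x y} → x ∈ ⟪ H ⟫ → y ∈ ⟪ H ⟫ → x + y ∈ ⟪ H ⟫
      -‿closed : ∀ {x} → x ∈ ⟪ H ⟫ → - x ∈ ⟪ H ⟫

  coset : Carrier → Subset order → Pred Carrier _
  coset g H x = ∃ λ h → h ∈ ⟪ H ⟫ × x ≈ g + h

  IsCoset : (H X : Subset order) → Set _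
  IsCoset H X = ∃ λ g → ⟪ X ⟫ ≐ coset g H

  IsUnionOfTwoCosets : (H X : Subset order) → Set _
  IsUnionOfTwoCosets H X = ∃₂ λ g g′ →
    ¬ (coset g H ≐ coset g′ H) × ⟪ X ⟫ ≐ coset g H ∪ coset g′ H

{-# OPTIONS --safe #-}
module Submission where

-- Let C be the complement of A ∧[ S ] B.  For z ∈ C every representation
-- z = x + (z - x) with x ∈ A, z - x ∈ B has δ x = x - (z - x) ∈ S, while
-- ∣A∣ + ∣B∣ is so large that all x with δ x ∈ S must occur: hence
--   1_A(x) + 1_B(z - x) = 1 + 1_S(δ x)  for all x,  and  z + S ⊆ 2·G.
-- Comparing these identities at a, b, c ∈ C around a hexagon shows that s ∈ S
-- implies s + (a - b) ∈ S, s + (c - a) ∈ S or s + 2(c - b) ∈ S.  If the last fails,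
-- then for fixed b, c, s every a ∈ C lies in (b - s + S) ∪ (s + c - S), and
-- ∣C∣ = 2∣S∣ makes this union disjoint and equal to C; so s and b determine c
-- modulo the stabiliser H of S.  Conversely 2(c - b) ∈ H implies c - b ∈ H, so every
-- c ∈ C outside b + H occurs with some s, hence with a whole coset of H of them.
-- Counting the pairs (c , s) with s + 2(c - b) ∉ S now gives 2∣S∣ - ∣H∣ ≤ ∣S∣, so S
-- is a coset of H.

open import Defs
open import Algebra.Bundles using (AbelianGroup)
open import Data.Fin.Base using (Fin; zero; suc)
open import Data.Fin.Properties using (any?)
open import Data.Fin.Subset using (Subset; Nonempty; ∣_∣; ∁)
open import Data.Fin.Subset.Properties using (_∈?_; ∣∁p∣≡n∸∣p∣; x∈∁p⇒x∉p)
open import Data.Integer.Base using (+_; _⊖_)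
open import Data.Nat.Base using (ℕ; zero; suc; _+_; _*_; _∸_; _≤_; _<_; z≤n; s≤s; >-nonZero)
open import Data.Product.Base using (_×_; _,_; proj₁; proj₂; ∃; ∃-syntax)
open import Data.Sum.Base using (_⊎_; inj₁; inj₂; [_,_]′)
open import Data.Vec.Base using ([]; _∷_; lookup)
open import Data.Vec.N-ary using (N-ary; Eq; curryⁿ; curryⁿ-cong; _$ⁿ_)
open import Data.Vec.Properties using (lookup∘tabulate; []=⇒lookup; lookup⇒[]=)
open import Function.Base using (_∘_)
open import Function.Bundles using (Inverse)
open import Level using (Level)
open import Relation.Binary.PropositionalEquality using (_≡_; cong; cong₂; subst)
open import Relation.Nullary.Decidable
  using (Dec; yes; no; does; map′; ¬?; _×-dec_; True; toWitness; dec-true; decidable-stable)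
open import Relation.Nullary.Negation using (¬_; contradiction)
open import Relation.Unary using (Pred; Decidable; _∈_; _⊆_)
import Algebra.Properties.AbelianGroup as AbelianGroupProperties
import Algebra.Properties.CommutativeSemigroup as CommutativeSemigroupProperties
import Algebra.Properties.Semiring.Sum as SemiringSum
import Algebra.Solver.CommutativeMonoid as CommutativeMonoidSolver
import Data.Fin.Subset as Fin
import Data.Integer.Base as ℤ
import Data.Integer.Properties as ℤ
import Data.Nat.Properties as ℕ
import Data.Vec.Base as Vec
import Function.Construct.Composition as Composition
import Function.Construct.Symmetry as Symmetry
import Relation.Binary.PropositionalEquality as ≡
import Relation.Binary.Reasoning.Setoid as SetoidReasoning

private
  variable
    p q : Level

-- A solver for identities in abelian groups.

-- An expression e is split as e + neg e ≈ pos e with neg e and pos e free of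
-- inverses, so that identities reduce to the solver for commutative monoids.
module AbelianGroupSolver {c ℓ} (G : AbelianGroup c ℓ) where
  open AbelianGroup G
  open AbelianGroupProperties G using (∙-cancelʳ)
  open CommutativeSemigroupProperties commutativeSemigroup using (interchange; xy∙z≈xz∙y)
  open CommutativeMonoidSolver commutativeMonoid
    using (Env; normalise; ⟦_⟧⇓; normalise-correct; _≟_)
    renaming (Expr to Additive; var to ‵var; _⊕_ to _‵⊕_; id to ‵id; ⟦_⟧ to ‵⟦_⟧)
  open SetoidReasoning setoid

  infixl 6 _⊕_ _⊝_

  data Expr (n : ℕ) : Set where
    var     : Fin n → Expr n
    _⊕_ _⊝_ : Expr n → Expr n → Expr n

  private
    variable
      n : ℕ

  ⟦_⟧ : Expr n → Env n → Carrier
  ⟦ var i ⟧ ρ = lookup ρ i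
  ⟦ d ⊕ e ⟧ ρ = ⟦ d ⟧ ρ ∙ ⟦ e ⟧ ρ
  ⟦ d ⊝ e ⟧ ρ = ⟦ d ⟧ ρ - ⟦ e ⟧ ρ

  pos neg : Expr n → Additive n
  pos (var i) = ‵var i
  pos (d ⊕ e) = pos d ‵⊕ pos e
  pos (d ⊝ e) = pos d ‵⊕ neg e
  neg (var i) = ‵id
  neg (d ⊕ e) = neg d ‵⊕ neg e
  neg (d ⊝ e) = neg d ‵⊕ pos e

  ‵⟦pos⟧ : ∀ (e : Expr n) ρ → ⟦ e ⟧ ρ ∙ ‵⟦ neg e ⟧ ρ ≈ ‵⟦ pos e ⟧ ρ
  ‵⟦pos⟧ (var i) ρ = identityʳ _
  ‵⟦pos⟧ (d ⊕ e) ρ = trans (interchange _ _ _ _) (∙-cong (‵⟦pos⟧ d ρ) (‵⟦pos⟧ e ρ))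
  ‵⟦pos⟧ (d ⊝ e) ρ = begin
    (x - y) ∙ (d⁻ ∙ ‵⟦ pos e ⟧ ρ)  ≈⟨ ∙-congˡ (∙-congˡ (‵⟦pos⟧ e ρ)) ⟨
    (x - y) ∙ (d⁻ ∙ (y ∙ e⁻))      ≈⟨ interchange _ _ _ _ ⟩
    (x ∙ d⁻) ∙ (y ⁻¹ ∙ (y ∙ e⁻))    ≈⟨ ∙-cong (‵⟦pos⟧ d ρ) (sym (assoc _ _ _)) ⟩
    ‵⟦ pos d ⟧ ρ ∙ (y ⁻¹ ∙ y ∙ e⁻)  ≈⟨ ∙-congˡ (∙-congʳ (inverseˡ y)) ⟩
    ‵⟦ pos d ⟧ ρ ∙ (ε ∙ e⁻)         ≈⟨ ∙-congˡ (identityˡ e⁻) ⟩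
    ‵⟦ pos d ⟧ ρ ∙ e⁻               ∎
    where
    x = ⟦ d ⟧ ρ
    y = ⟦ e ⟧ ρ
    d⁻ = ‵⟦ neg d ⟧ ρ
    e⁻ = ‵⟦ neg e ⟧ ρ

  prove : ∀ (d e : Expr n) →
          normalise (pos d ‵⊕ neg e) ≡ normalise (pos e ‵⊕ neg d) →
          ∀ ρ → ⟦ d ⟧ ρ ≈ ⟦ e ⟧ ρ
  prove d e eq ρ = ∙-cancelʳ d⁻ _ _ (∙-cancelʳ e⁻ _ _ (begin
    ⟦ d ⟧ ρ ∙ d⁻ ∙ e⁻                  ≈⟨ ∙-congʳ (‵⟦pos⟧ d ρ) ⟩
    ‵⟦ pos d ⟧ ρ ∙ e⁻                  ≈⟨ normalise-correct (pos d ‵⊕ neg e) ρ ⟨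
    ⟦ normalise (pos d ‵⊕ neg e) ⟧⇓ ρ  ≡⟨ cong (λ v → ⟦ v ⟧⇓ ρ) eq ⟩
    ⟦ normalise (pos e ‵⊕ neg d) ⟧⇓ ρ  ≈⟨ normalise-correct (pos e ‵⊕ neg d) ρ ⟩
    ‵⟦ pos e ⟧ ρ ∙ d⁻                  ≈⟨ ∙-congʳ (‵⟦pos⟧ e ρ) ⟨
    ⟦ e ⟧ ρ ∙ e⁻ ∙ d⁻                  ≈⟨ xy∙z≈xz∙y _ _ _ ⟩
    ⟦ e ⟧ ρ ∙ d⁻ ∙ e⁻                  ∎))
    where
    d⁻ = ‵⟦ neg d ⟧ ρ
    e⁻ = ‵⟦ neg e ⟧ ρ

  infix 4 _⊜_

  _⊜_ : Expr n → Expr n → Expr n × Expr n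
  _⊜_ = _,_

  close : ∀ {A : Set} n → N-ary n (Expr n) A → A
  close n f = f $ⁿ Vec.map var (Vec.allFin n)

  solve : ∀ n (f : N-ary n (Expr n) (Expr n × Expr n)) →
          (let (d , e) = close n f) →
          {True (normalise (pos d ‵⊕ neg e) ≟ normalise (pos e ‵⊕ neg d))} →
          Eq n _≈_ (curryⁿ ⟦ d ⟧) (curryⁿ ⟦ e ⟧)
  solve n f {t} =
    let (d , e) = close n f in curryⁿ-cong _≈_ ⟦ d ⟧ ⟦ e ⟧ (prove d e (toWitness t))

-- Indicators and finite sums of natural numbers.

open SemiringSum ℕ.+-*-semiring
  using (sum; sum-cong-≗; sum-permute; ∑-distrib-+; ∑-comm; *-distribʳ-sum)

𝟙 : {P : Set p} → Dec P → ℕ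
𝟙 (yes _) = 1
𝟙 (no _)  = 0

𝟙-yes : {P : Set p} (P? : Dec P) → P → 𝟙 P? ≡ 1
𝟙-yes (yes _) _ = ≡.refl
𝟙-yes (no ¬p) p = contradiction p ¬p

𝟙-no : {P : Set p} (P? : Dec P) → ¬ P → 𝟙 P? ≡ 0
𝟙-no (yes p) ¬p = contradiction p ¬p
𝟙-no (no _)  _  = ≡.refl

𝟙-mono : {P : Set p} {Q : Set q} (P? : Dec P) (Q? : Dec Q) → (P → Q) → 𝟙 P? ≤ 𝟙 Q?
𝟙-mono (yes p) Q? f = ℕ.≤-reflexive (≡.sym (𝟙-yes Q? (f p)))
𝟙-mono (no _)  Q? f = z≤n

𝟙-cong : {P : Set p} {Q : Set q} (P? : Dec P) (Q? : Dec Q) → (P → Q) → (Q → P) → 𝟙 P? ≡ 𝟙 Q?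
𝟙-cong P? Q? f g = ℕ.≤-antisym (𝟙-mono P? Q? f) (𝟙-mono Q? P? g)

𝟙-positive : {P : Set p} (P? : Dec P) → 0 < 𝟙 P? → P
𝟙-positive (yes p) _ = p

sum-mono : ∀ {n} {f g : Fin n → ℕ} → (∀ i → f i ≤ g i) → sum f ≤ sum g
sum-mono {zero}  f≤g = z≤n
sum-mono {suc n} f≤g = ℕ.+-mono-≤ (f≤g zero) (sum-mono (f≤g ∘ suc))

-- If the totals leave no slack, no single term can have any. Each cardinality argument of the proof
-- becomes a pointwise identity of indicators in this way.
sum-tight : ∀ {n} {f g : Fin n → ℕ} → (∀ i → f i ≤ g i) → sum g ≤ sum f → ∀ i → f i ≡ g i
sum-tight {suc n} {f} {g} f≤g g≤f zero = ℕ.≤-antisym (f≤g zero)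
  (ℕ.+-cancelʳ-≤ (sum (f ∘ suc)) _ _
    (ℕ.≤-trans (ℕ.+-monoʳ-≤ (g zero) (sum-mono (f≤g ∘ suc))) g≤f))
sum-tight {suc n} {f} {g} f≤g g≤f (suc i) = sum-tight (f≤g ∘ suc)
  (ℕ.+-cancelˡ-≤ (f zero) _ _
    (ℕ.≤-trans (ℕ.+-monoˡ-≤ _ (f≤g zero)) g≤f)) i

sum-const-1 : ∀ n → sum {n} (λ _ → 1) ≡ n
sum-const-1 zero    = ≡.refl
sum-const-1 (suc n) = cong suc (sum-const-1 n)

sum-zero : ∀ {n} {f : Fin n → ℕ} → (∀ i → f i ≡ 0) → sum f ≡ 0
sum-zero {zero}  f≡0 = ≡.refl
sum-zero {suc n} f≡0 = cong₂ _+_ (f≡0 zero) (sum-zero (f≡0 ∘ suc))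

term≤sum : ∀ {n} (f : Fin n → ℕ) i → f i ≤ sum f
term≤sum f zero    = ℕ.m≤m+n _ _
term≤sum f (suc i) = ℕ.≤-trans (term≤sum (f ∘ suc) i) (ℕ.m≤n+m _ _)

∣∣≡sum : ∀ {n} (X : Subset n) → ∣ X ∣ ≡ sum (λ i → 𝟙 (i ∈? X))
∣∣≡sum []                = ≡.refl
∣∣≡sum (Fin.inside ∷ X)  = cong suc (≡.trans (∣∣≡sum X)
  (sum-cong-≗ λ i → 𝟙-cong (i ∈? X) (suc i ∈? (Fin.inside ∷ X)) Vec.there λ { (Vec.there m) → m }))
∣∣≡sum (Fin.outside ∷ X) = ≡.trans (∣∣≡sum X)
  (sum-cong-≗ λ i → 𝟙-cong (i ∈? X) (suc i ∈? (Fin.outside ∷ X)) Vec.there λ { (Vec.there m) → m })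

-- Counting elements of the group through its enumeration.

module Counting {c ℓ} (G : FiniteAbelianGroup c ℓ) where
  open FiniteAbelianGroup G renaming (_+_ to infixl 6 _∔_)
  open Inverse enumeration using (to; from; to-cong; strictlyInverseˡ; strictlyInverseʳ)
  open Subsets G
  open AbelianGroupSolver abelianGroup

  Σᴳ : (Carrier → ℕ) → ℕ
  Σᴳ f = sum (f ∘ from)

  # : {P : Pred Carrier p} → Decidable P → ℕ
  # P? = Σᴳ (𝟙 ∘ P?)

  -- Conjugating `π` by the enumeration gives a permutation of `Fin order`. A round trip through the
  -- indices returns a point only up to `≈`, so `f` has to respect `≈`.
  Σᴳ-permute : ∀ {f} → (∀ {x y} → x ≈ y → f x ≡ f y) → (π : Inverse ≈-setoid ≈-setoid) →
               Σᴳ (f ∘ Inverse.to π) ≡ Σᴳ f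
  Σᴳ-permute {f} f-cong π = ≡.trans
    (sum-cong-≗ {order} λ i → f-cong (sym (strictlyInverseʳ (Inverse.to π (from i)))))
    (≡.sym (sum-permute (f ∘ from)
      (Composition.inverse (Symmetry.inverse enumeration) (Composition.inverse π enumeration))))

  involution : (f : Carrier → Carrier) → (∀ {x y} → x ≈ y → f x ≈ f y) → (∀ x → f (f x) ≈ x) →
               Inverse ≈-setoid ≈-setoid
  involution f f-cong f² = record
    { to = f ; from = f ; to-cong = f-cong ; from-cong = f-cong
    ; inverse = (λ y≈fx → trans (f-cong y≈fx) (f² _)) , (λ y≈fx → trans (f-cong y≈fx) (f² _)) }

  reflection : Carrier → Inverse ≈-setoid ≈-setoid
  reflection t = involution (λ x → t - x) (λ x≈y → ∙-congˡ (⁻¹-cong x≈y))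
    (solve 2 (λ t x → t ⊝ (t ⊝ x) ⊜ x) t)

  translation : Carrier → Inverse ≈-setoid ≈-setoid
  translation t = record
    { to = _∔ t ; from = _- t ; to-cong = ∙-congʳ ; from-cong = ∙-congʳ
    ; inverse = (λ {x} y≈x-t → trans (∙-congʳ y≈x-t) (solve 2 (λ x t → (x ⊝ t) ⊕ t ⊜ x) x t))
              , (λ {x} y≈x+t → trans (∙-congʳ y≈x+t) (solve 2 (λ x t → (x ⊕ t) ⊝ t ⊜ x) x t)) }

  𝟙-∈-cong : ∀ X {x y} → x ≈ y → 𝟙 (x ∈ᴳ? X) ≡ 𝟙 (y ∈ᴳ? X)
  𝟙-∈-cong X x≈y = cong (λ i → 𝟙 (i ∈? X)) (to-cong x≈y)

  ∣∣≡# : ∀ X → ∣ X ∣ ≡ # (_∈ᴳ? X)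
  ∣∣≡# X = ≡.trans (∣∣≡sum X)
    (sum-cong-≗ λ i → cong (λ j → 𝟙 (j ∈? X)) (≡.sym (strictlyInverseˡ i)))

  #-permute : ∀ X (π : Inverse ≈-setoid ≈-setoid) → # ((_∈ᴳ? X) ∘ Inverse.to π) ≡ ∣ X ∣
  #-permute X π = ≡.trans (Σᴳ-permute (𝟙-∈-cong X) π) (≡.sym (∣∣≡# X))

  Σᴳ-mono : ∀ {f g} → (∀ x → f x ≤ g x) → Σᴳ f ≤ Σᴳ g
  Σᴳ-mono f≤g = sum-mono (f≤g ∘ from)

  -- `sum-tight` speaks about the representatives `from i`; the congruence hypotheses carry the
  -- equality to every `x`.
  Σᴳ-tight : ∀ {f g} → (∀ {x y} → x ≈ y → f x ≡ f y) → (∀ {x y} → x ≈ y → g x ≡ g y) →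
             (∀ x → f x ≤ g x) → Σᴳ g ≤ Σᴳ f → ∀ x → f x ≡ g x
  Σᴳ-tight f-cong g-cong f≤g Σg≤Σf x = ≡.trans (f-cong (sym (strictlyInverseʳ x)))
    (≡.trans (sum-tight (f≤g ∘ from) Σg≤Σf (to x)) (g-cong (strictlyInverseʳ x)))

  Σᴳ-comm : ∀ (f : Carrier → Carrier → ℕ) → Σᴳ (λ x → Σᴳ (f x)) ≡ Σᴳ (λ y → Σᴳ (λ x → f x y))
  Σᴳ-comm f = ∑-comm (λ i j → f (from i) (from j))

  Σᴳ-+ : ∀ f g → Σᴳ (λ x → f x + g x) ≡ Σᴳ f + Σᴳ g
  Σᴳ-+ f g = ∑-distrib-+ (f ∘ from) (g ∘ from)

  Σᴳ-* : ∀ f n → Σᴳ (λ x → f x * n) ≡ Σᴳ f * n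
  Σᴳ-* f n = ≡.sym (*-distribʳ-sum n (f ∘ from))

  Σᴳ-∣∣* : ∀ X n → Σᴳ (λ x → 𝟙 (x ∈ᴳ? X) * n) ≡ ∣ X ∣ * n
  Σᴳ-∣∣* X n = ≡.trans (Σᴳ-* (λ x → 𝟙 (x ∈ᴳ? X)) n) (cong (_* n) (≡.sym (∣∣≡# X)))

  #-witnessed-≤ : ∀ {P : Pred Carrier p} (P? : Decidable P) {m} →
                  (∀ {x} → P x → # P? ≤ m) → # P? ≤ m
  #-witnessed-≤ P? bound with any? (P? ∘ from)
  ... | yes (i , Pi) = bound Pi
  ... | no ¬P = ℕ.≤-trans (ℕ.≤-reflexive (sum-zero λ i → 𝟙-no (P? (from i)) λ Pi → ¬P (i , Pi))) z≤n

  #-witness : ∀ {P : Pred Carrier p} (P? : Decidable P) → 0 < # P? → ∃ P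
  #-witness P? 0<#P with any? (P? ∘ from)
  ... | yes (i , Pi) = from i , Pi
  ... | no ¬P = contradiction (sum-zero λ i → 𝟙-no (P? (from i)) λ Pi → ¬P (i , Pi)) (ℕ.>⇒≢ 0<#P)

  #-positive : ∀ {P : Pred Carrier p} (P? : Decidable P) → (∀ {x y} → x ≈ y → P x → P y) →
               ∀ {x} → P x → 0 < # P?
  #-positive P? P-resp {x} Px = ℕ.<-≤-trans
    (ℕ.≤-reflexive (≡.sym (𝟙-yes (P? (from (to x))) (P-resp (sym (strictlyInverseʳ x)) Px))))
    (term≤sum (𝟙 ∘ P? ∘ from) (to x))

  module _ {P : Pred Carrier p} (P? : Decidable P) (P-resp : ∀ {x y} → x ≈ y → P x → P y) where

    ∈-comprehension⁺ : ∀ {x} → P x → x ∈ ⟪ comprehension P? ⟫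
    ∈-comprehension⁺ {x} Px = lookup⇒[]= (to x) _ (≡.trans (lookup∘tabulate _ (to x))
      (dec-true (P? (from (to x))) (P-resp (sym (strictlyInverseʳ x)) Px)))

    ∈-comprehension⁻ : ∀ {x} → x ∈ ⟪ comprehension P? ⟫ → P x
    ∈-comprehension⁻ {x} x∈
      with P? (from (to x)) | ≡.trans (≡.sym (lookup∘tabulate (does ∘ P? ∘ from) (to x))) ([]=⇒lookup x∈)
    -- In the `no` case the second scrutinee would equate `false` with `true`, so this clause is the
    -- whole split.
    ... | yes Px | _ = P-resp (strictlyInverseʳ x) Px

    ∣comprehension∣ : ∣ comprehension P? ∣ ≡ # P?
    ∣comprehension∣ = ≡.trans (∣∣≡# (comprehension P?))
      (sum-cong-≗ λ i → 𝟙-cong (from i ∈ᴳ? comprehension P?) (P? (from i)) ∈-comprehension⁻ ∈-comprehension⁺)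

-- Halves and two-torsion.

module Extremal {c ℓ} (G : FiniteAbelianGroup c ℓ) where
  open FiniteAbelianGroup G renaming (_+_ to infixl 6 _∔_)
  open Inverse enumeration using (to; from; strictlyInverseʳ)
  open Subsets G
  open AbelianGroupSolver abelianGroup
  open AbelianGroupProperties abelianGroup using (⁻¹-anti-homo‿-; ⁻¹-involutive)
  open Counting G

  double-cong : ∀ {x y} → x ≈ y → x ∔ x ≈ y ∔ y
  double-cong x≈y = ∙-cong x≈y x≈y

  twoTorsion? : Decidable (λ x → x ∔ x ≈ 0#)
  twoTorsion? x = (x ∔ x) ≟ 0#

  twoTorsion-resp : ∀ {x y} → x ≈ y → x ∔ x ≈ 0# → y ∔ y ≈ 0#
  twoTorsion-resp x≈y = trans (sym (double-cong x≈y))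

  Lᴳ≡# : Lᴳ ≡ # twoTorsion?
  Lᴳ≡# = ∣comprehension∣ twoTorsion? twoTorsion-resp

  0<Lᴳ : 0 < Lᴳ
  0<Lᴳ = subst (0 <_) (≡.sym Lᴳ≡#) (#-positive twoTorsion? twoTorsion-resp (identityˡ 0#))

  -- Subtracting one solution `x₀` sends all solutions injectively into the two-torsion; if there is
  -- no solution, the count is 0.
  halves≤Lᴳ : ∀ w → # (λ x → (x ∔ x) ≟ w) ≤ Lᴳ
  halves≤Lᴳ w = #-witnessed-≤ (λ x → (x ∔ x) ≟ w) λ {x₀} 2x₀≈w → begin
    # (λ x → (x ∔ x) ≟ w)  ≤⟨ Σᴳ-mono (λ x → 𝟙-mono ((x ∔ x) ≟ w) (twoTorsion? (x - x₀)) λ 2x≈w →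
      trans (solve 2 (λ x y → (x ⊝ y) ⊕ (x ⊝ y) ⊜ (x ⊕ x) ⊝ (y ⊕ y)) x x₀)
        (trans (∙-cong 2x≈w (⁻¹-cong 2x₀≈w)) (inverseʳ w))) ⟩
    # (λ x → twoTorsion? (x - x₀))  ≡⟨ Σᴳ-permute
      (λ x≈y → 𝟙-cong (twoTorsion? _) (twoTorsion? _) (twoTorsion-resp x≈y) (twoTorsion-resp (sym x≈y)))
      (translation (- x₀)) ⟩
    # twoTorsion?  ≡⟨ Lᴳ≡# ⟨
    Lᴳ             ∎
    where open ℕ.≤-Reasoning

  -- Tight counting at an element missing from the restricted sumset.

  module Missing
    (A B S C : Subset order)
    (∣A∣+∣B∣ : ∣ A ∣ + ∣ B ∣ ≡ order + ∣ S ∣ * Lᴳ)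
    (∣C∣ : ∣ C ∣ ≡ ∣ S ∣ + ∣ S ∣)
    (C-misses : ∀ {z a b} → z ∈ ⟪ C ⟫ → a ∈ ⟪ A ⟫ → b ∈ ⟪ B ⟫ → z ≈ a ∔ b → (a - b) ∈ ⟪ S ⟫)
    where

    module AtMissing {z} (z∈C : z ∈ ⟪ C ⟫) where

      -- The difference of the two summands in `z = x + (z - x)`, that is `2x - z`.
      δ : Carrier → Carrier
      δ x = x - (z - x)

      δ-cong : ∀ {x y} → x ≈ y → δ x ≈ δ y
      δ-cong x≈y = ∙-cong x≈y (⁻¹-cong (∙-congˡ (⁻¹-cong x≈y)))

      -- Since `δ x` is `2x - z`, the equation says `δ x = y`: these are the fibres of `δ` over `S`,
      -- written as sets of halves so that `halves≤Lᴳ` applies.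
      half? : ∀ y → Decidable (λ x → y ∈ ⟪ S ⟫ × x ∔ x ≈ z ∔ y)
      half? y x = (y ∈ᴳ? S) ×-dec ((x ∔ x) ≟ (z ∔ y))

      half-resp : ∀ {x y y′} → y ≈ y′ → y ∈ ⟪ S ⟫ × x ∔ x ≈ z ∔ y → y′ ∈ ⟪ S ⟫ × x ∔ x ≈ z ∔ y′
      half-resp y≈y′ (y∈S , eq) = ⟪⟫-resp-≈ S y≈y′ y∈S , trans eq (∙-congˡ y≈y′)

      represented : Carrier → ℕ
      represented x = 𝟙 (x ∈ᴳ? A) + 𝟙 ((z - x) ∈ᴳ? B)

      allowed : Carrier → ℕ
      allowed x = 1 + 𝟙 (δ x ∈ᴳ? S)

      represented-cong : ∀ {x y} → x ≈ y → represented x ≡ represented y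
      represented-cong x≈y = cong₂ _+_ (𝟙-∈-cong A x≈y) (𝟙-∈-cong B (∙-congˡ (⁻¹-cong x≈y)))

      meet : ∀ {x} → x ∈ ⟪ A ⟫ → (z - x) ∈ ⟪ B ⟫ → δ x ∈ ⟪ S ⟫
      meet {x} x∈A z-x∈B = C-misses z∈C x∈A z-x∈B (solve 2 (λ z x → z ⊜ x ⊕ (z ⊝ x)) z x)

      represented≤allowed : ∀ x → represented x ≤ allowed x
      represented≤allowed x with x ∈ᴳ? A | (z - x) ∈ᴳ? B
      ... | yes x∈A | yes z-x∈B = ℕ.≤-reflexive (cong suc (≡.sym (𝟙-yes (δ x ∈ᴳ? S) (meet x∈A z-x∈B))))
      ... | yes _   | no _      = s≤s z≤n
      ... | no _    | yes _     = s≤s z≤n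
      ... | no _    | no _      = z≤n

      Σ-represented : Σᴳ represented ≡ order + ∣ S ∣ * Lᴳ
      Σ-represented = ≡.trans (Σᴳ-+ (λ x → 𝟙 (x ∈ᴳ? A)) (λ x → 𝟙 ((z - x) ∈ᴳ? B)))
        (≡.trans (cong₂ _+_ (≡.sym (∣∣≡# A)) (#-permute B (reflection z))) ∣A∣+∣B∣)

      Σ-allowed : Σᴳ allowed ≡ order + # (λ x → δ x ∈ᴳ? S)
      Σ-allowed = ≡.trans (Σᴳ-+ (λ _ → 1) (λ x → 𝟙 (δ x ∈ᴳ? S)))
        (cong (_+ # (λ x → δ x ∈ᴳ? S)) (sum-const-1 order))

      -- Every `x` counted on the left lies in the fibre over `y = δ x`.
      #δ≤Σ-halves : # (λ x → δ x ∈ᴳ? S) ≤ Σᴳ (λ y → # (half? y))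
      #δ≤Σ-halves = begin
        # (λ x → δ x ∈ᴳ? S)                   ≤⟨ Σᴳ-mono (λ x → at x (δ x ∈ᴳ? S)) ⟩
        Σᴳ (λ x → # (λ y → half? y x))        ≡⟨ Σᴳ-comm (λ x y → 𝟙 (half? y x)) ⟩
        Σᴳ (λ y → # (half? y))                ∎
        where
        open ℕ.≤-Reasoning
        at : ∀ x (δx∈S? : Dec (δ x ∈ ⟪ S ⟫)) → 𝟙 δx∈S? ≤ # (λ y → half? y x)
        at x (no _)     = z≤n
        at x (yes δx∈S) = #-positive (λ y → half? y x) half-resp
          (δx∈S , solve 2 (λ x z → x ⊕ x ⊜ z ⊕ (x ⊝ (z ⊝ x))) x z)

      #half≤ : ∀ y → # (half? y) ≤ 𝟙 (y ∈ᴳ? S) * Lᴳ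
      #half≤ y = #-witnessed-≤ (half? y) λ (y∈S , _) → begin
        # (half? y)                  ≤⟨ Σᴳ-mono (λ x → 𝟙-mono (half? y x) ((x ∔ x) ≟ (z ∔ y)) proj₂) ⟩
        # (λ x → (x ∔ x) ≟ (z ∔ y))  ≤⟨ halves≤Lᴳ (z ∔ y) ⟩
        Lᴳ                           ≡⟨ ℕ.*-identityˡ Lᴳ ⟨
        1 * Lᴳ                       ≡⟨ cong (_* Lᴳ) (𝟙-yes (y ∈ᴳ? S) y∈S) ⟨
        𝟙 (y ∈ᴳ? S) * Lᴳ             ∎
        where open ℕ.≤-Reasoning

      Σ-halves≤ : Σᴳ (λ y → # (half? y)) ≤ ∣ S ∣ * Lᴳ
      Σ-halves≤ = ℕ.≤-trans (Σᴳ-mono #half≤) (ℕ.≤-reflexive (Σᴳ-∣∣* S Lᴳ))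

      -- The hypothesis on `∣ A ∣ + ∣ B ∣` fixes the total of `represented`. The total of `allowed`
      -- is no larger, because each of the `∣ S ∣` fibres of `δ` has at most `Lᴳ` points. So
      -- `represented≤allowed` is tight.
      represented≡allowed : ∀ x → represented x ≡ allowed x
      represented≡allowed = Σᴳ-tight represented-cong (λ x≈y → cong suc (𝟙-∈-cong S (δ-cong x≈y)))
        represented≤allowed (begin
          Σᴳ allowed                 ≡⟨ Σ-allowed ⟩
          order + # (λ x → δ x ∈ᴳ? S)  ≤⟨ ℕ.+-monoʳ-≤ order (ℕ.≤-trans #δ≤Σ-halves Σ-halves≤) ⟩
          order + ∣ S ∣ * Lᴳ         ≡⟨ Σ-represented ⟨
          Σᴳ represented             ∎)
        where open ℕ.≤-Reasoning

      cover : ∀ {x} → ¬ (x ∈ ⟪ A ⟫) → (z - x) ∈ ⟪ B ⟫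
      cover {x} x∉A with x ∈ᴳ? A | (z - x) ∈ᴳ? B | represented≡allowed x
      ... | yes x∈A | _         | _ = contradiction x∈A x∉A
      ... | no _    | yes z-x∈B | _ = z-x∈B
      ... | no _    | no _      | ()

      -- Here `allowed x` is 2, which forces both indicators in `represented x` to be 1.
      meet⁻¹ : ∀ {x} → δ x ∈ ⟪ S ⟫ → x ∈ ⟪ A ⟫ × (z - x) ∈ ⟪ B ⟫
      meet⁻¹ {x} δx∈S with x ∈ᴳ? A | (z - x) ∈ᴳ? B | δ x ∈ᴳ? S | represented≡allowed x
      ... | yes x∈A | yes z-x∈B | _       | _ = x∈A , z-x∈B
      ... | _       | _         | no δx∉S | _ = contradiction δx∈S δx∉S
      ... | yes _   | no _      | yes _   | ()
      ... | no _    | yes _     | yes _   | ()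
      ... | no _    | no _      | yes _   | ()

      -- The same chain of bounds is tight in its other half too: the fibre over `s` has exactly
      -- `Lᴳ` points, and `Lᴳ` is positive.
      halve : ∀ {s} → s ∈ ⟪ S ⟫ → ∃ λ x → x ∔ x ≈ z ∔ s
      halve {s} s∈S = let (x , _ , eq) = #-witness (half? s) 0<#half in x , eq
        where
        open ℕ.≤-Reasoning
        #half-cong : ∀ {y y′} → y ≈ y′ → # (half? y) ≡ # (half? y′)
        #half-cong {y} {y′} y≈y′ = sum-cong-≗ λ i →
          𝟙-cong (half? y (from i)) (half? y′ (from i)) (half-resp y≈y′) (half-resp (sym y≈y′))
        #half≡ : # (half? s) ≡ 𝟙 (s ∈ᴳ? S) * Lᴳ
        #half≡ = Σᴳ-tight #half-cong (λ x≈y → cong (_* Lᴳ) (𝟙-∈-cong S x≈y)) #half≤ (begin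
          Σᴳ (λ y → 𝟙 (y ∈ᴳ? S) * Lᴳ)  ≡⟨ Σᴳ-∣∣* S Lᴳ ⟩
          -- The pointwise bound of `represented` by `allowed`, summed and with `order` cancelled,
          -- bounds the number of `x` with `δ x` in `S` from below.
          ∣ S ∣ * Lᴳ                    ≤⟨ ℕ.+-cancelˡ-≤ order _ _ (begin
            order + ∣ S ∣ * Lᴳ            ≡⟨ Σ-represented ⟨
            Σᴳ represented                ≤⟨ Σᴳ-mono represented≤allowed ⟩
            Σᴳ allowed                    ≡⟨ Σ-allowed ⟩
            order + # (λ x → δ x ∈ᴳ? S)   ∎) ⟩
          # (λ x → δ x ∈ᴳ? S)           ≤⟨ #δ≤Σ-halves ⟩
          Σᴳ (λ y → # (half? y))        ∎) s
        0<#half : 0 < # (half? s)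
        0<#half = begin-strict
          0                 <⟨ 0<Lᴳ ⟩
          Lᴳ                ≡⟨ ℕ.*-identityˡ Lᴳ ⟨
          1 * Lᴳ            ≡⟨ cong (_* Lᴳ) (𝟙-yes (s ∈ᴳ? S) s∈S) ⟨
          𝟙 (s ∈ᴳ? S) * Lᴳ  ≡⟨ #half≡ ⟨
          # (half? s)       ∎

      δ-onto : ∀ {s} → s ∈ ⟪ S ⟫ → ∃ λ x → s ≈ δ x
      δ-onto {s} s∈S =
        let (x , 2x≈z+s) = halve s∈S in
        x , trans (solve 2 (λ z s → s ⊜ (z ⊕ s) ⊝ z) z s)
              (trans (∙-congʳ (sym 2x≈z+s)) (solve 2 (λ x z → (x ⊕ x) ⊝ z ⊜ x ⊝ (z ⊝ x)) x z))

    -- Comparing the identities at several missing elements.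

    open AtMissing

    -- Write `s = δ x` at `b`, so that `x` is in `A`. At `b` the point `x - (c - b)` has difference
    -- `s - 2(c - b)`, so its partner, which equals `c - x`, is in `B`. Now `x` and `c - x` meet at
    -- `c`, with difference `s - (c - b)`.
    convex : ∀ {b c s} → b ∈ ⟪ C ⟫ → c ∈ ⟪ C ⟫ → s ∈ ⟪ S ⟫ →
             (s - ((c - b) ∔ (c - b))) ∈ ⟪ S ⟫ → (s - (c - b)) ∈ ⟪ S ⟫
    convex {b} {c} {s} b∈C c∈C s∈S s-2d∈S =
      let (x , s≈δx) = δ-onto b∈C s∈S
          (x∈A , _) = meet⁻¹ b∈C (⟪⟫-resp-≈ S s≈δx s∈S)
          (_ , b-x′∈B) = meet⁻¹ b∈C {x - (c - b)} (⟪⟫-resp-≈ S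
            (trans (∙-congʳ s≈δx) (solve 3 (λ x b c →
              (x ⊝ (b ⊝ x)) ⊝ ((c ⊝ b) ⊕ (c ⊝ b)) ⊜ (x ⊝ (c ⊝ b)) ⊝ (b ⊝ (x ⊝ (c ⊝ b)))) x b c))
            s-2d∈S)
          c-x∈B = ⟪⟫-resp-≈ B (solve 3 (λ x b c → b ⊝ (x ⊝ (c ⊝ b)) ⊜ c ⊝ x) x b c) b-x′∈B
      in ⟪⟫-resp-≈ S
           (trans (solve 3 (λ x b c → x ⊝ (c ⊝ x) ⊜ (x ⊝ (b ⊝ x)) ⊝ (c ⊝ b)) x b c) (∙-congʳ (sym s≈δx)))
           (meet c∈C x∈A c-x∈B)

    -- Writing s = δ x, the points x, x + (c - a), x + (c - b) of A chase membership
    -- of the six points a - x, b - x, ... in B around a hexagon.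
    hexagon : ∀ {a b c s} → a ∈ ⟪ C ⟫ → b ∈ ⟪ C ⟫ → c ∈ ⟪ C ⟫ → s ∈ ⟪ S ⟫ →
              ¬ (s ∔ (a - b)) ∈ ⟪ S ⟫ → ¬ (s ∔ (c - a)) ∈ ⟪ S ⟫ →
              (s ∔ ((c - b) ∔ (c - b))) ∈ ⟪ S ⟫
    hexagon {a} {b} {c} {s} a∈C b∈C c∈C s∈S s+a-b∉S s+c-a∉S =
      ⟪⟫-resp-≈ S
        (trans (solve 4 (λ x a b c →
            (x ⊕ (c ⊝ b)) ⊝ (a ⊝ (x ⊕ (c ⊝ b))) ⊜ (x ⊝ (a ⊝ x)) ⊕ ((c ⊝ b) ⊕ (c ⊝ b))) x a b c)
          (∙-congʳ (sym s≈δx)))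
        (meet a∈C x₃∈A (⟪⟫-resp-≈ B
          (solve 4 (λ x a b c → b ⊝ (x ⊕ (c ⊝ a)) ⊜ a ⊝ (x ⊕ (c ⊝ b))) x a b c) (cover b∈C x₂∉A)))
      where
      x = proj₁ (δ-onto a∈C s∈S)
      s≈δx = proj₂ (δ-onto a∈C s∈S)
      x∈A×a-x∈B = meet⁻¹ a∈C (⟪⟫-resp-≈ S s≈δx s∈S)
      b-x∉B : ¬ (b - x) ∈ ⟪ B ⟫
      b-x∉B b-x∈B = s+a-b∉S (⟪⟫-resp-≈ S
        (trans (solve 3 (λ x a b → x ⊝ (b ⊝ x) ⊜ (x ⊝ (a ⊝ x)) ⊕ (a ⊝ b)) x a b) (∙-congʳ (sym s≈δx)))
        (meet b∈C (proj₁ x∈A×a-x∈B) b-x∈B))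
      x₂∉A : ¬ (x ∔ (c - a)) ∈ ⟪ A ⟫
      x₂∉A x₂∈A = s+c-a∉S (⟪⟫-resp-≈ S
        (trans (solve 3 (λ x a c → (x ⊕ (c ⊝ a)) ⊝ (c ⊝ (x ⊕ (c ⊝ a))) ⊜ (x ⊝ (a ⊝ x)) ⊕ (c ⊝ a)) x a c)
          (∙-congʳ (sym s≈δx)))
        (meet c∈C x₂∈A (⟪⟫-resp-≈ B
          (solve 3 (λ x a c → a ⊝ x ⊜ c ⊝ (x ⊕ (c ⊝ a))) x a c) (proj₂ x∈A×a-x∈B))))
      x₃∈A : (x ∔ (c - b)) ∈ ⟪ A ⟫
      x₃∈A = decidable-stable ((x ∔ (c - b)) ∈ᴳ? A) λ x₃∉A →
        b-x∉B (⟪⟫-resp-≈ B (solve 3 (λ x b c → c ⊝ (x ⊕ (c ⊝ b)) ⊜ b ⊝ x) x b c) (cover c∈C x₃∉A))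

    -- The stabiliser `H` of `S`, and `C` modulo `H`.

    Stabilises : Pred Carrier _
    Stabilises h = ∀ {x} → x ∈ ⟪ S ⟫ → (x ∔ h) ∈ ⟪ S ⟫

    -- A failure of stability, quantified over indices so that a finite search decides it. This
    -- makes the universal `Stabilises` decidable and lets `H` be a `Subset`.
    Moved : Carrier → Set _
    Moved h = ∃ λ i → from i ∈ ⟪ S ⟫ × ¬ (from i ∔ h) ∈ ⟪ S ⟫

    moved? : ∀ h → Dec (Moved h)
    moved? h = any? λ i → (from i ∈ᴳ? S) ×-dec ¬? ((from i ∔ h) ∈ᴳ? S)

    ¬moved⇒stabilises : ∀ {h} → ¬ Moved h → Stabilises h
    ¬moved⇒stabilises {h} ¬moved {x} x∈S = decidable-stable ((x ∔ h) ∈ᴳ? S) λ x+h∉S →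
      ¬moved (to x , ⟪⟫-resp-≈ S (sym (strictlyInverseʳ x)) x∈S
                   , λ x+h∈S → x+h∉S (⟪⟫-resp-≈ S (∙-congʳ (strictlyInverseʳ x)) x+h∈S))

    Stabilises? : Decidable Stabilises
    Stabilises? h = map′ ¬moved⇒stabilises
      (λ stable moved → let (_ , x∈S , x+h∉S) = moved in x+h∉S (stable x∈S))
      (¬? (moved? h))

    Stabilises-resp : ∀ {h k} → h ≈ k → Stabilises h → Stabilises k
    Stabilises-resp h≈k stable x∈S = ⟪⟫-resp-≈ S (∙-congˡ h≈k) (stable x∈S)

    H : Subset order
    H = comprehension Stabilises?

    ∈H⁺ : ∀ {h} → Stabilises h → h ∈ ⟪ H ⟫
    ∈H⁺ = ∈-comprehension⁺ Stabilises? Stabilises-resp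

    ∈H⁻ : ∀ {h} → h ∈ ⟪ H ⟫ → Stabilises h
    ∈H⁻ = ∈-comprehension⁻ Stabilises? Stabilises-resp

    moved : ∀ {h} → ¬ h ∈ ⟪ H ⟫ → ∃ λ s → s ∈ ⟪ S ⟫ × ¬ (s ∔ h) ∈ ⟪ S ⟫
    moved {h} h∉H =
      let (i , s∈S , s+h∉S) = decidable-stable (moved? h) (h∉H ∘ λ ¬moved → ∈H⁺ (¬moved⇒stabilises ¬moved))
      in from i , s∈S , s+h∉S

    0∈H : 0# ∈ ⟪ H ⟫
    0∈H = ∈H⁺ λ {x} → ⟪⟫-resp-≈ S (sym (identityʳ x))

    H-+-closed : ∀ {h k} → h ∈ ⟪ H ⟫ → k ∈ ⟪ H ⟫ → (h ∔ k) ∈ ⟪ H ⟫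
    H-+-closed h∈H k∈H = ∈H⁺ λ x∈S → ⟪⟫-resp-≈ S (assoc _ _ _) (∈H⁻ k∈H (∈H⁻ h∈H x∈S))

    -- S + h ⊆ S forces S + h = S because S is finite.
    H-‿closed : ∀ {h} → h ∈ ⟪ H ⟫ → (- h) ∈ ⟪ H ⟫
    H-‿closed {h} h∈H = ∈H⁺ λ {x} x∈S → 𝟙-positive ((x - h) ∈ᴳ? S)
      (ℕ.≤-reflexive (≡.sym (≡.trans (S≡S+h (x - h))
        (𝟙-yes (((x - h) ∔ h) ∈ᴳ? S) (⟪⟫-resp-≈ S (solve 2 (λ x h → x ⊜ (x ⊝ h) ⊕ h) x h) x∈S)))))
      where
      S≡S+h : ∀ x → 𝟙 (x ∈ᴳ? S) ≡ 𝟙 ((x ∔ h) ∈ᴳ? S)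
      S≡S+h = Σᴳ-tight (𝟙-∈-cong S) (λ x≈y → 𝟙-∈-cong S (∙-congʳ x≈y))
        (λ x → 𝟙-mono (x ∈ᴳ? S) ((x ∔ h) ∈ᴳ? S) (∈H⁻ h∈H))
        (ℕ.≤-reflexive (≡.trans (#-permute S (translation h)) (∣∣≡# S)))

    H-swap : ∀ {x y} → (x - y) ∈ ⟪ H ⟫ → (y - x) ∈ ⟪ H ⟫
    H-swap = ⟪⟫-resp-≈ H (⁻¹-anti-homo‿- _ _) ∘ H-‿closed

    H-isSubgroup : IsSubgroup H
    H-isSubgroup = record { 0∈ = 0∈H ; +-closed = H-+-closed ; -‿closed = H-‿closed }

    -- If `2(c - b)` stabilises `S`, so does its negative; `convex` then fills in the midpoint
    -- `s - (c - b)` for every `s` in `S`, so `-(c - b)` stabilises `S`.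
    H-halve : ∀ {b c} → b ∈ ⟪ C ⟫ → c ∈ ⟪ C ⟫ → ((c - b) ∔ (c - b)) ∈ ⟪ H ⟫ → (c - b) ∈ ⟪ H ⟫
    H-halve b∈C c∈C 2d∈H = ⟪⟫-resp-≈ H (⁻¹-involutive _)
      (H-‿closed (∈H⁺ λ s∈S → convex b∈C c∈C s∈S (∈H⁻ (H-‿closed 2d∈H) s∈S)))

    -- The terms on the right are the indicators of `b - s + S` and `s + c - S`. By `hexagon` these
    -- sets cover `C`, and their sizes add up to `∣ C ∣`, so the bound is tight; equality contains
    -- their disjointness.
    𝟙C≡ : ∀ {b c s} → b ∈ ⟪ C ⟫ → c ∈ ⟪ C ⟫ → s ∈ ⟪ S ⟫ → ¬ (s ∔ ((c - b) ∔ (c - b))) ∈ ⟪ S ⟫ →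
          ∀ a → 𝟙 (a ∈ᴳ? C) ≡ 𝟙 ((s ∔ (a - b)) ∈ᴳ? S) + 𝟙 ((s ∔ (c - a)) ∈ᴳ? S)
    𝟙C≡ {b} {c} {s} b∈C c∈C s∈S s+2d∉S = Σᴳ-tight (𝟙-∈-cong C)
      (λ x≈y → cong₂ _+_ (𝟙-∈-cong S (∙-congˡ (∙-congʳ x≈y))) (𝟙-∈-cong S (∙-congˡ (∙-congˡ (⁻¹-cong x≈y)))))
      pointwise
      (ℕ.≤-reflexive (≡.trans (Σᴳ-+ (λ a → 𝟙 ((s ∔ (a - b)) ∈ᴳ? S)) (λ a → 𝟙 ((s ∔ (c - a)) ∈ᴳ? S)))
        (≡.trans (cong₂ _+_ ∣left∣ ∣right∣) (≡.trans (≡.sym ∣C∣) (∣∣≡# C)))))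
      where
      pointwise : ∀ a → 𝟙 (a ∈ᴳ? C) ≤ 𝟙 ((s ∔ (a - b)) ∈ᴳ? S) + 𝟙 ((s ∔ (c - a)) ∈ᴳ? S)
      pointwise a with a ∈ᴳ? C | (s ∔ (a - b)) ∈ᴳ? S | (s ∔ (c - a)) ∈ᴳ? S
      ... | no _    | _      | _      = z≤n
      ... | yes _   | yes _  | _      = s≤s z≤n
      ... | yes _   | no _   | yes _  = s≤s z≤n
      ... | yes a∈C | no ∉₁  | no ∉₂  = contradiction (hexagon a∈C b∈C c∈C s∈S ∉₁ ∉₂) s+2d∉S
      ∣left∣ : # (λ a → (s ∔ (a - b)) ∈ᴳ? S) ≡ ∣ S ∣
      ∣left∣ = ≡.trans (sum-cong-≗ {order} λ i → 𝟙-∈-cong S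
        (solve 3 (λ s a b → s ⊕ (a ⊝ b) ⊜ a ⊕ (s ⊝ b)) s (from i) b)) (#-permute S (translation (s - b)))
      ∣right∣ : # (λ a → (s ∔ (c - a)) ∈ᴳ? S) ≡ ∣ S ∣
      ∣right∣ = ≡.trans (sum-cong-≗ {order} λ i → 𝟙-∈-cong S
        (solve 3 (λ s a c → s ⊕ (c ⊝ a) ⊜ (s ⊕ c) ⊝ a) s (from i) c)) (#-permute S (reflection (s ∔ c)))

    -- In `𝟙C≡` for `c` and for `c′` the first term is the same. Hence the second terms agree, and
    -- `s + c - S = s + c′ - S`.
    same-coset : ∀ {b c c′ s} → b ∈ ⟪ C ⟫ → c ∈ ⟪ C ⟫ → c′ ∈ ⟪ C ⟫ → s ∈ ⟪ S ⟫ →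
                 ¬ (s ∔ ((c - b) ∔ (c - b))) ∈ ⟪ S ⟫ → ¬ (s ∔ ((c′ - b) ∔ (c′ - b))) ∈ ⟪ S ⟫ →
                 (c′ - c) ∈ ⟪ H ⟫
    same-coset {b} {c} {c′} {s} b∈C c∈C c′∈C s∈S ∉₁ ∉₂ = ∈H⁺ λ {t} t∈S →
      -- Chosen so that `s + (c - a)` is `t`; then `s + (c′ - a)` is `t + (c′ - c)`.
      let a = (s ∔ c) - t
          eq = ℕ.+-cancelˡ-≡ (𝟙 ((s ∔ (a - b)) ∈ᴳ? S)) _ _
                 (≡.trans (≡.sym (𝟙C≡ b∈C c∈C s∈S ∉₁ a)) (𝟙C≡ b∈C c′∈C s∈S ∉₂ a))
          t′∈S = 𝟙-positive ((s ∔ (c′ - a)) ∈ᴳ? S) (ℕ.≤-reflexive (≡.trans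
                   (≡.sym (𝟙-yes ((s ∔ (c - a)) ∈ᴳ? S)
                     (⟪⟫-resp-≈ S (solve 3 (λ s c t → t ⊜ s ⊕ (c ⊝ ((s ⊕ c) ⊝ t))) s c t) t∈S))) eq))
      in ⟪⟫-resp-≈ S (solve 4 (λ s c c′ t → s ⊕ (c′ ⊝ ((s ⊕ c) ⊝ t)) ⊜ t ⊕ (c′ ⊝ c)) s c c′ t) t′∈S

    -- Double counting of the pairs `(c , s)` for a fixed `b`.

    Pair : (b c s : Carrier) → Set _
    Pair b c s = s ∈ ⟪ S ⟫ × c ∈ ⟪ C ⟫ × ¬ (s ∔ ((c - b) ∔ (c - b))) ∈ ⟪ S ⟫

    pair? : ∀ b c s → Dec (Pair b c s)
    pair? b c s = (s ∈ᴳ? S) ×-dec (c ∈ᴳ? C) ×-dec ¬? ((s ∔ ((c - b) ∔ (c - b))) ∈ᴳ? S)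

    #-translate-H : ∀ x → # (λ y → (y - x) ∈ᴳ? H) ≡ ∣ H ∣
    #-translate-H x = #-permute H (translation (- x))

    -- By `same-coset`, all `c` paired with one `s` lie in a single coset of `H`.
    pairs-over-s : ∀ {b} → b ∈ ⟪ C ⟫ → ∀ s → # (λ c → pair? b c s) ≤ 𝟙 (s ∈ᴳ? S) * ∣ H ∣
    pairs-over-s {b} b∈C s = #-witnessed-≤ (λ c → pair? b c s) λ {c₀} (s∈S , c₀∈C , ∉₁) → begin
      # (λ c → pair? b c s)     ≤⟨ Σᴳ-mono (λ c → 𝟙-mono (pair? b c s) ((c - c₀) ∈ᴳ? H)
                                     λ (_ , c∈C , ∉₂) → same-coset b∈C c₀∈C c∈C s∈S ∉₁ ∉₂) ⟩
      # (λ c → (c - c₀) ∈ᴳ? H)  ≡⟨ #-translate-H c₀ ⟩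
      ∣ H ∣                     ≡⟨ ℕ.*-identityˡ ∣ H ∣ ⟨
      1 * ∣ H ∣                 ≡⟨ cong (_* ∣ H ∣) (𝟙-yes (s ∈ᴳ? S) s∈S) ⟨
      𝟙 (s ∈ᴳ? S) * ∣ H ∣       ∎
      where open ℕ.≤-Reasoning

    -- By `H-halve`, `2(c - b)` is outside `H` as well, so it moves some element of `S` out of `S`.
    separates : ∀ {b c} → b ∈ ⟪ C ⟫ → c ∈ ⟪ C ⟫ → ¬ (c - b) ∈ ⟪ H ⟫ → ∃ (Pair b c)
    separates b∈C c∈C c-b∉H =
      let (s , s∈S , ∉S) = moved (c-b∉H ∘ H-halve b∈C c∈C) in s , s∈S , c∈C , ∉S

    -- For `c` outside `b + H`, one separating `s` brings along its whole coset `s + H`, since `S`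
    -- and its complement are both invariant under `H`. The last term pays for the `c` inside
    -- `b + H`.
    pairs-over-c : ∀ {b} → b ∈ ⟪ C ⟫ → ∀ c →
                   𝟙 (c ∈ᴳ? C) * ∣ H ∣ ≤ # (pair? b c) + 𝟙 ((c - b) ∈ᴳ? H) * ∣ H ∣
    pairs-over-c {b} b∈C c = bound (c ∈ᴳ? C) ((c - b) ∈ᴳ? H)
      where
      open ℕ.≤-Reasoning
      bound : (c∈C? : Dec (c ∈ ⟪ C ⟫)) (c-b∈H? : Dec ((c - b) ∈ ⟪ H ⟫)) →
              𝟙 c∈C? * ∣ H ∣ ≤ # (pair? b c) + 𝟙 c-b∈H? * ∣ H ∣
      bound (no _)    _          = z≤n
      bound (yes _)   (yes _)    = ℕ.m≤n+m (1 * ∣ H ∣) (# (pair? b c))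
      bound (yes c∈C) (no c-b∉H) = begin
        1 * ∣ H ∣                ≡⟨ ℕ.*-identityˡ ∣ H ∣ ⟩
        ∣ H ∣                    ≡⟨ #-translate-H s ⟨
        # (λ x → (x - s) ∈ᴳ? H)  ≤⟨ Σᴳ-mono (λ x → 𝟙-mono ((x - s) ∈ᴳ? H) (pair? b c x) (pair x)) ⟩
        # (pair? b c)            ≡⟨ ℕ.+-identityʳ _ ⟨
        # (pair? b c) + 0        ∎
        where
        s,pair = separates b∈C c∈C c-b∉H
        s = proj₁ s,pair
        pair : ∀ x → (x - s) ∈ ⟪ H ⟫ → Pair b c x
        pair x x-s∈H =
          let (s∈S , _ , s+2d∉S) = proj₂ s,pair in
          ⟪⟫-resp-≈ S (solve 2 (λ s x → s ⊕ (x ⊝ s) ⊜ x) s x) (∈H⁻ x-s∈H s∈S)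
          , c∈C
          , λ x+2d∈S → s+2d∉S (⟪⟫-resp-≈ S
              (solve 3 (λ s x e → (x ⊕ e) ⊕ (s ⊝ x) ⊜ s ⊕ e) s x ((c - b) ∔ (c - b)))
              (∈H⁻ (H-swap x-s∈H) x+2d∈S))

    -- With `N` the number of pairs, `2∣S∣∣H∣ = ∣C∣∣H∣ ≤ N + ∣H∣²` and `N ≤ ∣S∣∣H∣`. Cancelling
    -- `∣S∣∣H∣` and then the positive factor `∣H∣` gives the bound.
    ∣S∣≤∣H∣ : ∀ {b} → b ∈ ⟪ C ⟫ → ∣ S ∣ ≤ ∣ H ∣
    ∣S∣≤∣H∣ {b} b∈C = ℕ.*-cancelʳ-≤ (∣ S ∣) (∣ H ∣) (∣ H ∣) {{>-nonZero 0<∣H∣}}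
      (ℕ.+-cancelˡ-≤ (∣ S ∣ * ∣ H ∣) _ _ (begin
        ∣ S ∣ * ∣ H ∣ + ∣ S ∣ * ∣ H ∣
          ≡⟨ ℕ.*-distribʳ-+ (∣ H ∣) (∣ S ∣) (∣ S ∣) ⟨
        (∣ S ∣ + ∣ S ∣) * ∣ H ∣
          ≡⟨ cong (_* ∣ H ∣) ∣C∣ ⟨
        ∣ C ∣ * ∣ H ∣
          ≡⟨ Σᴳ-∣∣* C ∣ H ∣ ⟨
        Σᴳ (λ c → 𝟙 (c ∈ᴳ? C) * ∣ H ∣)
          ≤⟨ Σᴳ-mono (pairs-over-c b∈C) ⟩
        Σᴳ (λ c → # (pair? b c) + 𝟙 ((c - b) ∈ᴳ? H) * ∣ H ∣)
          ≡⟨ Σᴳ-+ (λ c → # (pair? b c)) (λ c → 𝟙 ((c - b) ∈ᴳ? H) * ∣ H ∣) ⟩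
        Σᴳ (λ c → # (pair? b c)) + Σᴳ (λ c → 𝟙 ((c - b) ∈ᴳ? H) * ∣ H ∣)
          ≡⟨ cong₂ _+_ (Σᴳ-comm (λ c s → 𝟙 (pair? b c s))) (≡.trans (Σᴳ-* (λ c → 𝟙 ((c - b) ∈ᴳ? H)) ∣ H ∣)
               (cong (_* ∣ H ∣) (#-translate-H b))) ⟩
        Σᴳ (λ s → # (λ c → pair? b c s)) + ∣ H ∣ * ∣ H ∣
          ≤⟨ ℕ.+-monoˡ-≤ _ (Σᴳ-mono (pairs-over-s b∈C)) ⟩
        Σᴳ (λ s → 𝟙 (s ∈ᴳ? S) * ∣ H ∣) + ∣ H ∣ * ∣ H ∣
          ≡⟨ cong (_+ ∣ H ∣ * ∣ H ∣) (Σᴳ-∣∣* S ∣ H ∣) ⟩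
        ∣ S ∣ * ∣ H ∣ + ∣ H ∣ * ∣ H ∣
          ∎))
      where
      open ℕ.≤-Reasoning
      0<∣H∣ : 0 < ∣ H ∣
      0<∣H∣ = subst (0 <_) (≡.sym (∣∣≡# H)) (#-positive (_∈ᴳ? H) (⟪⟫-resp-≈ H) 0∈H)

    -- `S` as one coset of `H`, and `C` as two.

    module Conclusion {s} (s∈S : s ∈ ⟪ S ⟫) where

      0<∣S∣ : 0 < ∣ S ∣
      0<∣S∣ = subst (0 <_) (≡.sym (∣∣≡# S)) (#-positive (_∈ᴳ? S) (⟪⟫-resp-≈ S) s∈S)

      ∣S∣<∣C∣ : ∣ S ∣ < ∣ C ∣
      ∣S∣<∣C∣ = subst (∣ S ∣ <_) (≡.sym ∣C∣) (ℕ.m<m+n ∣ S ∣ 0<∣S∣)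

      C-nonempty : ∃ (_∈ ⟪ C ⟫)
      C-nonempty = #-witness (_∈ᴳ? C) (subst (0 <_) (∣∣≡# C) (ℕ.<-trans 0<∣S∣ ∣S∣<∣C∣))

      b = proj₁ C-nonempty
      b∈C = proj₂ C-nonempty

      -- Both `b + s` and `b + (s + h)` are doubles by `halve`, and `h` is their difference.
      H⊆2·G : ⟪ H ⟫ ⊆ 2·G
      H⊆2·G {h} h∈H =
        let (x , 2x≈b+s) = halve b∈C s∈S
            (y , 2y≈b+s+h) = halve b∈C (∈H⁻ h∈H s∈S)
        in y - x , (begin
          h                                  ≈⟨ solve 3 (λ b s h → h ⊜ (b ⊕ (s ⊕ h)) ⊝ (b ⊕ s)) b s h ⟩
          (b ∔ (s ∔ h)) - (b ∔ s)            ≈⟨ ∙-cong 2y≈b+s+h (⁻¹-cong 2x≈b+s) ⟨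
          (y ∔ y) - (x ∔ x)                  ≈⟨ solve 2 (λ x y → (y ⊕ y) ⊝ (x ⊕ x) ⊜ (y ⊝ x) ⊕ (y ⊝ x)) x y ⟩
          (y - x) ∔ (y - x)                  ∎)
        where open SetoidReasoning ≈-setoid

      ∈coset⁺ : ∀ {g x} → (x - g) ∈ ⟪ H ⟫ → x ∈ coset g H
      ∈coset⁺ {g} {x} x-g∈H = x - g , x-g∈H , solve 2 (λ g x → x ⊜ g ⊕ (x ⊝ g)) g x

      ∈coset⁻ : ∀ {g x} → x ∈ coset g H → (x - g) ∈ ⟪ H ⟫
      ∈coset⁻ {g} {x} (h , h∈H , x≈g+h) = ⟪⟫-resp-≈ H
        (trans (solve 2 (λ g h → h ⊜ (g ⊕ h) ⊝ g) g h) (∙-congʳ (sym x≈g+h))) h∈H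

      H+x⊆S : ∀ {t x} → t ∈ ⟪ S ⟫ → (x - t) ∈ ⟪ H ⟫ → x ∈ ⟪ S ⟫
      H+x⊆S {t} {x} t∈S x-t∈H = ⟪⟫-resp-≈ S (solve 2 (λ t x → t ⊕ (x ⊝ t) ⊜ x) t x) (∈H⁻ x-t∈H t∈S)

      -- The coset `t + H` lies in `S` and, by `∣S∣≤∣H∣`, is not smaller than `S`.
      𝟙S≡ : ∀ {t} → t ∈ ⟪ S ⟫ → ∀ x → 𝟙 ((x - t) ∈ᴳ? H) ≡ 𝟙 (x ∈ᴳ? S)
      𝟙S≡ {t} t∈S = Σᴳ-tight (λ x≈y → 𝟙-∈-cong H (∙-congʳ x≈y)) (𝟙-∈-cong S)
        (λ x → 𝟙-mono ((x - t) ∈ᴳ? H) (x ∈ᴳ? S) (H+x⊆S t∈S))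
        (begin
          # (_∈ᴳ? S)               ≡⟨ ∣∣≡# S ⟨
          ∣ S ∣                    ≤⟨ ∣S∣≤∣H∣ b∈C ⟩
          ∣ H ∣                    ≡⟨ #-translate-H t ⟨
          # (λ x → (x - t) ∈ᴳ? H)  ∎)
        where open ℕ.≤-Reasoning

      ∈S⇒-∈H : ∀ {t x} → t ∈ ⟪ S ⟫ → x ∈ ⟪ S ⟫ → (x - t) ∈ ⟪ H ⟫
      ∈S⇒-∈H {t} {x} t∈S x∈S = 𝟙-positive ((x - t) ∈ᴳ? H)
        (ℕ.≤-reflexive (≡.sym (≡.trans (𝟙S≡ t∈S x) (𝟙-yes (x ∈ᴳ? S) x∈S))))

      S-isCoset : IsCoset H S
      S-isCoset = s , (λ x∈S → ∈coset⁺ (∈S⇒-∈H s∈S x∈S)) , (λ x∈s+H → H+x⊆S s∈S (∈coset⁻ x∈s+H))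

      ∣H∣≤∣S∣ : ∣ H ∣ ≤ ∣ S ∣
      ∣H∣≤∣S∣ = begin
        ∣ H ∣                    ≡⟨ #-translate-H s ⟨
        # (λ x → (x - s) ∈ᴳ? H)  ≤⟨ Σᴳ-mono (λ x → 𝟙-mono ((x - s) ∈ᴳ? H) (x ∈ᴳ? S) (H+x⊆S s∈S)) ⟩
        # (_∈ᴳ? S)               ≡⟨ ∣∣≡# S ⟨
        ∣ S ∣                    ∎
        where open ℕ.≤-Reasoning

      -- Inside `b + H` alone, `C` would have at most `∣ H ∣ ≤ ∣ S ∣` elements, but it has `2∣S∣`
      -- and `S` is not empty.
      other-coset : ∃ λ c → c ∈ ⟪ C ⟫ × ¬ (c - b) ∈ ⟪ H ⟫
      other-coset with any? (λ i → (from i ∈ᴳ? C) ×-dec ¬? ((from i - b) ∈ᴳ? H))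
      ... | yes (i , i∈C , i-b∉H) = from i , i∈C , i-b∉H
      ... | no none = contradiction ∣C∣≤∣S∣ (ℕ.<⇒≱ ∣S∣<∣C∣)
        where
        open ℕ.≤-Reasoning
        in-b+H : ∀ i → 𝟙 (from i ∈ᴳ? C) ≤ 𝟙 ((from i - b) ∈ᴳ? H)
        in-b+H i = 𝟙-mono (from i ∈ᴳ? C) ((from i - b) ∈ᴳ? H) λ i∈C →
          decidable-stable ((from i - b) ∈ᴳ? H) λ i-b∉H → none (i , i∈C , i-b∉H)
        ∣C∣≤∣S∣ : ∣ C ∣ ≤ ∣ S ∣
        ∣C∣≤∣S∣ = begin
          ∣ C ∣                    ≡⟨ ∣∣≡# C ⟩
          # (_∈ᴳ? C)               ≤⟨ sum-mono in-b+H ⟩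
          # (λ x → (x - b) ∈ᴳ? H)  ≡⟨ #-translate-H b ⟩
          ∣ H ∣                    ≤⟨ ∣H∣≤∣S∣ ⟩
          ∣ S ∣                    ∎

      module _ {c t} (c∈C : c ∈ ⟪ C ⟫) (t∈S : t ∈ ⟪ S ⟫)
               (t+2d∉S : ¬ (t ∔ ((c - b) ∔ (c - b))) ∈ ⟪ S ⟫) where

        -- Because `S` is a single coset of `H`, the first two outcomes of `hexagon` at `t` say that
        -- `a - b` or `c - a` is in `H`; the choice of `t` excludes the third.
        C⊆b+H∪c+H : ∀ {a} → a ∈ ⟪ C ⟫ → a ∈ coset b H ⊎ a ∈ coset c H
        C⊆b+H∪c+H {a} a∈C = locate ((t ∔ (a - b)) ∈ᴳ? S) ((t ∔ (c - a)) ∈ᴳ? S)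
          where
          locate : Dec ((t ∔ (a - b)) ∈ ⟪ S ⟫) → Dec ((t ∔ (c - a)) ∈ ⟪ S ⟫) →
                   a ∈ coset b H ⊎ a ∈ coset c H
          locate (yes ∈₁) _        = inj₁ (∈coset⁺ (⟪⟫-resp-≈ H
            (solve 3 (λ t a b → (t ⊕ (a ⊝ b)) ⊝ t ⊜ a ⊝ b) t a b) (∈S⇒-∈H t∈S ∈₁)))
          locate (no _)   (yes ∈₂) = inj₂ (∈coset⁺ (H-swap (⟪⟫-resp-≈ H
            (solve 3 (λ t a c → (t ⊕ (c ⊝ a)) ⊝ t ⊜ c ⊝ a) t a c) (∈S⇒-∈H t∈S ∈₂))))
          locate (no ∉₁)  (no ∉₂)  = contradiction (hexagon a∈C b∈C c∈C t∈S ∉₁ ∉₂) t+2d∉S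

        -- Translating `t` by `a - b` in `H` stays in `S`, so the right side of `𝟙C≡` is positive at
        -- `a`.
        b+H⊆C : ∀ {a} → a ∈ coset b H → a ∈ ⟪ C ⟫
        b+H⊆C {a} a∈b+H = 𝟙-positive (a ∈ᴳ? C) (begin
          1
            ≡⟨ 𝟙-yes ((t ∔ (a - b)) ∈ᴳ? S) (∈H⁻ (∈coset⁻ a∈b+H) t∈S) ⟨
          𝟙 ((t ∔ (a - b)) ∈ᴳ? S)
            ≤⟨ ℕ.m≤m+n _ _ ⟩
          𝟙 ((t ∔ (a - b)) ∈ᴳ? S) + 𝟙 ((t ∔ (c - a)) ∈ᴳ? S)
            ≡⟨ 𝟙C≡ b∈C c∈C t∈S t+2d∉S a ⟨
          𝟙 (a ∈ᴳ? C)
            ∎)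
          where open ℕ.≤-Reasoning

        c+H⊆C : ∀ {a} → a ∈ coset c H → a ∈ ⟪ C ⟫
        c+H⊆C {a} a∈c+H = 𝟙-positive (a ∈ᴳ? C) (begin
          1
            ≡⟨ 𝟙-yes ((t ∔ (c - a)) ∈ᴳ? S) (∈H⁻ (H-swap (∈coset⁻ a∈c+H)) t∈S) ⟨
          𝟙 ((t ∔ (c - a)) ∈ᴳ? S)
            ≤⟨ ℕ.m≤n+m _ _ ⟩
          𝟙 ((t ∔ (a - b)) ∈ᴳ? S) + 𝟙 ((t ∔ (c - a)) ∈ᴳ? S)
            ≡⟨ 𝟙C≡ b∈C c∈C t∈S t+2d∉S a ⟨
          𝟙 (a ∈ᴳ? C)
            ∎)
          where open ℕ.≤-Reasoning

      C-isUnionOfTwoCosets : IsUnionOfTwoCosets H C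
      C-isUnionOfTwoCosets =
        let (c , c∈C , c-b∉H) = other-coset
            (t , t∈S , _ , t+2d∉S) = separates b∈C c∈C c-b∉H
        in b , c
           -- Equal cosets would put `c` itself into `b + H`.
           , (λ (_ , c+H⊆b+H) → c-b∉H (∈coset⁻ (c+H⊆b+H (∈coset⁺ (⟪⟫-resp-≈ H (sym (inverseʳ c)) 0∈H)))))
           , C⊆b+H∪c+H c∈C t∈S t+2d∉S
           , [ b+H⊆C c∈C t∈S t+2d∉S , c+H⊆C c∈C t∈S t+2d∉S ]′

-- Integer subtraction does not truncate, so the hypothesis on the size of the sumset also gives
-- `2∣S∣ ≤ order`; the additive form in natural numbers keeps this and yields `∣ C ∣ = 2∣S∣`.
m≡n⊖k⇒m+k≡n : ∀ {m n k} → + m ≡ n ⊖ k → m + k ≡ n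
m≡n⊖k⇒m+k≡n {m} {n} {k} eq = ℤ.+-injective (begin
  (+ m) ℤ.+ (+ k)                   ≡⟨ cong (λ i → i ℤ.+ (+ k)) (≡.trans eq (≡.sym (ℤ.m-n≡m⊖n n k))) ⟩
  ((+ n) ℤ.+ ℤ.- (+ k)) ℤ.+ (+ k)   ≡⟨ ℤ.+-assoc (+ n) (ℤ.- (+ k)) (+ k) ⟩
  (+ n) ℤ.+ (ℤ.- (+ k) ℤ.+ (+ k))   ≡⟨ cong (λ i → (+ n) ℤ.+ i) (ℤ.+-inverseˡ (+ k)) ⟩
  (+ n) ℤ.+ (+ 0)                   ≡⟨ ℤ.+-identityʳ (+ n) ⟩
  + n                               ∎)
  where open ≡.≡-Reasoning

theorem16 : ∀ {c ℓ} (G : FiniteAbelianGroup c ℓ) →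
    let open FiniteAbelianGroup G using (order)
        open Subsets G in
    (A B S : Subset order) → Nonempty A → Nonempty B → Nonempty S →
    ∣ A ∣ + ∣ B ∣ ≡ order + Lˢ S →
    Lˢ S ≡ ∣ S ∣ * Lᴳ →
    + ∣ A ∧[ S ] B ∣ ≡ order ⊖ 2 * ∣ S ∣ →
    ∃[ H ] (IsSubgroup H × ⟪ H ⟫ ⊆ 2·G × IsCoset H S ×
            IsUnionOfTwoCosets H (∁ (A ∧[ S ] B)))
theorem16 G A B S _ _ (i , i∈S) ∣A∣+∣B∣ Lˢ≡ ∣A∧B∣ =
  H , H-isSubgroup , H⊆2·G , S-isCoset , C-isUnionOfTwoCosets
  where
  open FiniteAbelianGroup G using (_≈_; order; trans; sym)
    renaming (_+_ to infixl 6 _∔_; _-_ to infixl 6 _-_)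
  open Inverse (FiniteAbelianGroup.enumeration G) using (from; strictlyInverseˡ)
  open Subsets G

  C : Subset order
  C = ∁ (A ∧[ S ] B)

  ∣C∣ : ∣ C ∣ ≡ ∣ S ∣ + ∣ S ∣
  ∣C∣ = begin
    ∣ C ∣                                           ≡⟨ ∣∁p∣≡n∸∣p∣ (A ∧[ S ] B) ⟩
    order ∸ ∣ A ∧[ S ] B ∣                          ≡⟨ cong (_∸ ∣ A ∧[ S ] B ∣) (m≡n⊖k⇒m+k≡n ∣A∧B∣) ⟨
    ∣ A ∧[ S ] B ∣ + 2 * ∣ S ∣ ∸ ∣ A ∧[ S ] B ∣     ≡⟨ ℕ.m+n∸m≡n ∣ A ∧[ S ] B ∣ _ ⟩
    2 * ∣ S ∣                                       ≡⟨ cong (λ k → ∣ S ∣ + k) (ℕ.+-identityʳ ∣ S ∣) ⟩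
    ∣ S ∣ + ∣ S ∣                                   ∎
    where open ≡.≡-Reasoning

  C-misses : ∀ {z a b} → z ∈ ⟪ C ⟫ → a ∈ ⟪ A ⟫ → b ∈ ⟪ B ⟫ → z ≈ a ∔ b → (a - b) ∈ ⟪ S ⟫
  C-misses {z} {a} {b} z∈C a∈A b∈B z≈a+b = decidable-stable ((a - b) ∈ᴳ? S) λ a-b∉S →
    x∈∁p⇒x∉p z∈C (Counting.∈-comprehension⁺ G (restrictedSum? A S B)
      (λ x≈y (a′ , b′ , mem , x≈a′+b′) → a′ , b′ , mem , trans (sym x≈y) x≈a′+b′)
      (a , b , (a∈A , b∈B , a-b∉S) , z≈a+b))

  open Extremal G
  open Missing A B S C (≡.trans ∣A∣+∣B∣ (cong (λ L → order + L) Lˢ≡)) ∣C∣ C-misses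
  open Conclusion {from i} (subst (Fin._∈ S) (≡.sym (strictlyInverseˡ i)) i∈S)
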